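{- Let $G$ be a tree, and let $G'$ be the graph obtained from $G$ by removing at most $k$ edges (keeping all vertices). Then $$0 \leq meg(G') \leq meg(G) + 2k.$$
   Context: Graphs are finite, undirected and simple. In a connected graph $H$, an edge $e$ is monitored by a pair of vertices $x,y$ if $e$ lies on all shortest paths between $x$ and $y$. A set $M\subseteq V(H)$ is a monitoring edge-geodetic set (MEG-set) of $H$ if every edge of $H$ is monitored by some pair of vertices of $M$; $meg(H)$ is the minimum size of a MEG-set of $H$. For a disconnected graph, a MEG-set is the union of MEG-sets of its connected components, where the MEG-set of an isolated vertex is taken to be empty; so $meg$ is the sum of the $meg$ of the components, an isolated vertex contributing $0$. -}

module Defs where

open import Data.Nat using (ℕ; zero; suc; _≤_; _≤?_; z≤n; s≤s)
import Data.Nat.Properties as ℕ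
open import Data.Fin using (Fin; zero; suc; _≟_)
open import Data.Fin.Properties using (any?; all?; injective⇒≤)
open import Data.Fin.Subset using (Subset; inside; outside; _∈_; _⊆_; _∩_; ∣_∣; Nonempty; Empty)
open import Data.Fin.Subset.Properties
  using (_∈?_; _⊆?_; nonempty?; anySubset?; x∈p∩q⁺)
open import Data.List using (List; []; _∷_; length; lookup; head; last; map; filter; _++_)
open import Data.List.Extrema.Nat using (min)
import Data.List.Membership.DecPropositional as DecMembership
import Data.List.Membership.Propositional as List
open import Data.List.Membership.Propositional.Properties using (∈-lookup)
open import Data.List.Relation.Binary.Infix.Heterogeneous using (Infix)
open import Data.List.Relation.Binary.Infix.Heterogeneous.Properties using (infix?)
import Data.List.Relation.Unary.All as All
open import Data.List.Relation.Unary.All using (All)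
open import Data.List.Relation.Unary.AllPairs using (_∷_)
open import Data.List.Relation.Unary.Linked using (Linked; linked?)
open import Data.List.Relation.Unary.Unique.Propositional using (Unique)
open import Data.List.Relation.Unary.Unique.DecPropositional using (unique?)
open import Data.Maybe using (just)
import Data.Maybe.Properties as Maybe
open import Data.Product using (∃-syntax; _×_; _,_)
import Data.Product.Properties as Product
open import Data.Sum using (_⊎_; inj₁; inj₂)
open import Data.Vec using ([]; _∷_)
open import Function using (_∘_)
open import Level using (0ℓ)
open import Relation.Binary using (Rel; Decidable; Symmetric; Irreflexive; DecidableEquality)
open import Relation.Binary.PropositionalEquality using (_≡_; refl; sym; cong)
open import Relation.Nullary using (¬_; Dec; yes; no; contradiction)
open import Relation.Nullary.Decidable
  using (map′; ¬?; _×-dec_; _⊎-dec_; _→-dec_; decidable-stable)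

-- The vertices are drawn from Fin n without having to exhaust it, so that
-- induced subgraphs (in particular components) have the same type.
record Graph (n : ℕ) : Set₁ where
  infix 4 _~_ _~?_
  field
    V      : Subset n
    _~_    : Rel (Fin n) 0ℓ
    _~?_   : Decidable _~_
    ~-sym  : Symmetric _~_
    ~-irr  : Irreflexive _≡_ _~_
    ~⇒∈V   : ∀ {u v} → u ~ v → u ∈ V

open Graph

private
  variable
    n : ℕ

infixl 6 _∖_
infix  7 _[_]

_[_] : Graph n → Subset n → Graph n
H [ C ] = record
  { V     = V H ∩ C
  ; _~_   = λ u v → _~_ H u v × u ∈ C × v ∈ C
  ; _~?_  = λ u v → _~?_ H u v ×-dec (u ∈? C) ×-dec (v ∈? C)
  ; ~-sym = λ (e , u∈C , v∈C) → ~-sym H e , v∈C , u∈C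
  ; ~-irr = λ u≡v (e , _) → ~-irr H u≡v e
  ; ~⇒∈V  = λ (e , u∈C , _) → x∈p∩q⁺ (~⇒∈V H e , u∈C)
  }

pair≟ : DecidableEquality (Fin n × Fin n)
pair≟ = Product.≡-dec _≟_ _≟_

-- In F, both (u , v) and (v , u) denote the edge uv.
_∖_ : Graph n → List (Fin n × Fin n) → Graph n
H ∖ F = record
  { V     = V H
  ; _~_   = λ u v → _~_ H u v × (u , v) List.∉ F × (v , u) List.∉ F
  ; _~?_  = λ u v → _~?_ H u v ×-dec ¬? (in? (u , v)) ×-dec ¬? (in? (v , u))
  ; ~-sym = λ (e , uv∉F , vu∉F) → ~-sym H e , vu∉F , uv∉F
  ; ~-irr = λ u≡v (e , _) → ~-irr H u≡v e
  ; ~⇒∈V  = λ (e , _) → ~⇒∈V H e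
  }
  where in? = λ e → DecMembership._∈?_ pair≟ e F

-- A path is given by the list of its vertices.
record IsPath (H : Graph n) (x y : Fin n) (p : List (Fin n)) : Set where
  constructor mkPath
  field
    starts   : head p ≡ just x
    ends     : last p ≡ just y
    vertices : All (_∈ V H) p
    linked   : Linked (_~_ H) p
    distinct : Unique p

IsShortestPath : Graph n → Fin n → Fin n → List (Fin n) → Set
IsShortestPath H x y p = IsPath H x y p × (∀ q → IsPath H x y q → length p ≤ length q)

EdgeOn : Fin n → Fin n → List (Fin n) → Set
EdgeOn u v p = Infix _≡_ (u ∷ v ∷ []) p ⊎ Infix _≡_ (v ∷ u ∷ []) p

Connected : Graph n → Set
Connected H = Nonempty (V H) × (∀ x y → x ∈ V H → y ∈ V H → ∃[ p ] IsPath H x y p)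

IsCycle : Graph n → List (Fin n) → Set
IsCycle H c =
  3 ≤ length c × Unique c × Linked (_~_ H) c ×
  ∃[ x ] ∃[ y ] head c ≡ just x × last c ≡ just y × _~_ H y x

IsTree : Graph n → Set
IsTree H = Connected H × (∀ c → ¬ IsCycle H c)

IsComponent : Graph n → Subset n → Set
IsComponent H C =
  C ⊆ V H × Connected (H [ C ]) ×
  (∀ D → D ⊆ V H → C ⊆ D → Connected (H [ D ]) → D ⊆ C)

Monitors : Graph n → (x y u v : Fin n) → Set
Monitors H x y u v = ∀ p → IsShortestPath H x y p → EdgeOn u v p

MonitorsAllEdges : Graph n → Subset n → Set
MonitorsAllEdges H M =
  ∀ u v → _~_ H u v → ∃[ x ] ∃[ y ] x ∈ M × y ∈ M × Monitors H x y u v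

-- Components are pairwise disjoint and cover V H, so M is a union of sets
-- M_C ⊆ C, one for each component C, exactly when M ⊆ V H, and then
-- M_C = M ∩ C.  The condition ∣ C ∣ ≡ 1 says that C is an isolated vertex.
IsMEGSet : Graph n → Subset n → Set
IsMEGSet H M =
  M ⊆ V H ×
  ((Connected H × MonitorsAllEdges H M) ⊎
   (¬ Connected H × (∀ C → IsComponent H C →
      MonitorsAllEdges (H [ C ]) (M ∩ C) × (∣ C ∣ ≡ 1 → Empty (M ∩ C)))))

allSubset? : {P : Subset n → Set} → (∀ C → Dec (P C)) → Dec (∀ C → P C)
allSubset? P? = map′
  (λ ¬∃ C → decidable-stable (P? C) (λ ¬p → ¬∃ (C , ¬p)))
  (λ ∀P (C , ¬p) → ¬p (∀P C))
  (¬? (anySubset? (¬? ∘ P?)))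

anyList? : ∀ m {P : List (Fin n) → Set} → (∀ p → Dec (P p)) →
           Dec (∃[ p ] length p ≤ m × P p)
anyList? zero P? = map′ (λ p → [] , z≤n , p) (λ { ([] , _ , p) → p }) (P? [])
anyList? (suc m) P? = map′
  (λ { (inj₁ p) → [] , z≤n , p
     ; (inj₂ (x , xs , l , p)) → x ∷ xs , s≤s l , p })
  (λ { ([] , _ , p) → inj₁ p
     ; (x ∷ xs , s≤s l , p) → inj₂ (x , xs , l , p) })
  (P? [] ⊎-dec any? (λ x → anyList? m (P? ∘ (x ∷_))))

lookup-inj : {p : List (Fin n)} → Unique p → ∀ i j → lookup p i ≡ lookup p j → i ≡ j
lookup-inj (_ ∷ _) zero zero _ = refl
lookup-inj {p = _ ∷ p} (x∉p ∷ _) zero (suc j) eq =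
  contradiction eq (All.lookup x∉p (∈-lookup j))
lookup-inj {p = _ ∷ p} (x∉p ∷ _) (suc i) zero eq =
  contradiction (sym eq) (All.lookup x∉p (∈-lookup i))
lookup-inj (_ ∷ u) (suc i) (suc j) eq = cong suc (lookup-inj u i j eq)

unique⇒length≤ : {p : List (Fin n)} → Unique p → length p ≤ n
unique⇒length≤ u = injective⇒≤ (λ {i} {j} → lookup-inj u i j)

isPath? : (H : Graph n) → ∀ x y p → Dec (IsPath H x y p)
isPath? H x y p = map′
  (λ (a , b , c , d , e) → mkPath a b c d e)
  (λ (mkPath a b c d e) → a , b , c , d , e)
  (Maybe.≡-dec _≟_ (head p) (just x) ×-dec Maybe.≡-dec _≟_ (last p) (just y)
    ×-dec All.all? (_∈? V H) p ×-dec linked? (_~?_ H) p ×-dec unique? _≟_ p)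

anyPath? : (H : Graph n) → ∀ x y {P : List (Fin n) → Set} → (∀ p → Dec (P p)) →
           Dec (∃[ p ] IsPath H x y p × P p)
anyPath? {n} H x y P? = map′
  (λ (p , _ , π , q) → p , π , q)
  (λ (p , π , q) → p , unique⇒length≤ (IsPath.distinct π) , π , q)
  (anyList? n (λ p → isPath? H x y p ×-dec P? p))

allPath? : (H : Graph n) → ∀ x y {P : List (Fin n) → Set} → (∀ p → Dec (P p)) →
           Dec (∀ p → IsPath H x y p → P p)
allPath? H x y P? = map′
  (λ ¬∃ p π → decidable-stable (P? p) (λ ¬q → ¬∃ (p , π , ¬q)))
  (λ ∀P (p , π , ¬q) → ¬q (∀P p π))
  (¬? (anyPath? H x y (¬? ∘ P?)))

connected? : (H : Graph n) → Dec (Connected H)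
connected? H = nonempty? (V H) ×-dec all? λ x → all? λ y →
  (x ∈? V H) →-dec ((y ∈? V H) →-dec map′
    (λ (p , π , _) → p , π) (λ (p , π) → p , π , π)
    (anyPath? H x y (isPath? H x y)))


isComponent? : (H : Graph n) → ∀ C → Dec (IsComponent H C)
isComponent? H C = (C ⊆? V H) ×-dec connected? (H [ C ]) ×-dec allSubset? λ D →
  (D ⊆? V H) →-dec ((C ⊆? D) →-dec (connected? (H [ D ]) →-dec (D ⊆? C)))

edgeOn? : ∀ (u v : Fin n) p → Dec (EdgeOn u v p)
edgeOn? u v p = infix? _≟_ (u ∷ v ∷ []) p ⊎-dec infix? _≟_ (v ∷ u ∷ []) p

monitors? : (H : Graph n) → ∀ x y u v → Dec (Monitors H x y u v)
monitors? H x y u v = map′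
  (λ f p (π , s) → f p π s) (λ f p π s → f p (π , s))
  (allPath? H x y λ p →
    allPath? H x y (λ q → length p ≤? length q) →-dec edgeOn? u v p)

monitorsAllEdges? : (H : Graph n) → ∀ M → Dec (MonitorsAllEdges H M)
monitorsAllEdges? H M = all? λ u → all? λ v → _~?_ H u v →-dec
  any? λ x → any? λ y → (x ∈? M) ×-dec (y ∈? M) ×-dec monitors? H x y u v

isMEGSet? : (H : Graph n) → ∀ M → Dec (IsMEGSet H M)
isMEGSet? H M = (M ⊆? V H) ×-dec
  ((connected? H ×-dec monitorsAllEdges? H M) ⊎-dec
   (¬? (connected? H) ×-dec allSubset? λ C → isComponent? H C →-dec
      (monitorsAllEdges? (H [ C ]) (M ∩ C) ×-dec
        ((∣ C ∣ ℕ.≟ 1) →-dec ¬? (nonempty? (M ∩ C))))))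

subsets : ∀ n → List (Subset n)
subsets zero    = [] ∷ []
subsets (suc n) = map (inside ∷_) (subsets n) ++ map (outside ∷_) (subsets n)

-- `min` needs a default; n never undercuts the true minimum, since every
-- subset of Fin n has at most n elements, and a MEG-set always exists: the
-- endpoints of an edge monitor it, so the non-isolated vertices form one.
meg : Graph n → ℕ
meg {n} H = min n (map ∣_∣ (filter (isMEGSet? H) (subsets n)))

{-# OPTIONS --safe #-}

-- Paths in a tree are unique, so an edge of G ∖ F is monitored as soon as it
-- lies on some path of G ∖ F between two vertices of the chosen set.  Given a
-- MEG-set M of G, we choose the vertices of M and the endpoints of the edges of
-- F that are not isolated in G ∖ F.  An edge uv of G ∖ F lies on the path of G
-- between two vertices of M; starting from uv and following this path in both
-- directions until it ends or meets an edge of F gives the required path.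

module Submission where

open import Defs
open import Data.Nat using (ℕ; suc; _+_; _*_; _≤_; z≤n; s≤s)
import Data.Nat.Properties as ℕ
open import Data.Fin using (Fin; _≟_)
open import Data.Fin.Properties using (any?)
open import Data.Fin.Subset
  using (Subset; inside; outside; _∈_; _⊆_; _∩_; _∪_; ⁅_⁆; ⊥; ∣_∣; Empty)
open import Data.Fin.Subset.Properties
  using ( _∈?_; x∈p∩q⁺; x∈p∩q⁻; p∩q⊆q; x∈p∪q⁻; p⊆p∪q; q⊆p∪q
        ; x∈⁅x⁆; x∈⁅y⁆⇒x≡y; ∣⁅x⁆∣≡1; ∣⊥∣≡0; p⊆q⇒∣p∣≤∣q∣; p⊂q⇒∣p∣<∣q∣)
open import Data.List using (List; []; _∷_; length; head; last; map; filter)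
open import Data.List.Extrema.Nat using (min; min≤⊤; min≤xs; argmin-sel)
import Data.List.Membership.Propositional as List
import Data.List.Membership.DecPropositional as DecMembership
open import Data.List.Membership.Propositional.Properties
  using (∈-map⁺; ∈-map⁻; ∈-filter⁺; ∈-filter⁻; ∈-++⁺ˡ; ∈-++⁺ʳ)
open import Data.List.Relation.Binary.Infix.Heterogeneous using (Infix; here; there)
open import Data.List.Relation.Binary.Prefix.Heterogeneous using (Prefix; []; _∷_)
open import Data.List.Relation.Binary.Sublist.Propositional
  using ([]; _∷ʳ_; _∷_; minimum) renaming (_⊆_ to Sublist)
open import Data.List.Relation.Binary.Sublist.Propositional.Properties using (All-resp-⊆)
import Data.List.Relation.Unary.All as All
open import Data.List.Relation.Unary.All using (All; []; _∷_)
open import Data.List.Relation.Unary.All.Properties using (¬Any⇒All¬)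
open import Data.List.Relation.Unary.AllPairs using ([]; _∷_)
open import Data.List.Relation.Unary.Any using (Any; here; there)
open import Data.List.Relation.Unary.Linked using (Linked; [-]; _∷_)
open import Data.List.Relation.Unary.Unique.Propositional using (Unique)
open import Data.Maybe using (just)
open import Data.Product using (_×_; _,_; proj₁; proj₂; ∃-syntax)
open import Data.Sum using (_⊎_; inj₁; inj₂; [_,_]′; swap)
open import Data.Vec using ([]; _∷_; tabulate)
open import Data.Vec.Properties using (lookup∘tabulate; []=⇒lookup; lookup⇒[]=)
open import Function using (_∘_; id)
open import Level using (0ℓ)
open import Relation.Binary using (Rel; Decidable; Symmetric)
open import Relation.Binary.Construct.Closure.ReflexiveTransitive as Star
  using (Star; ε; _◅_; _◅◅_)
open import Relation.Binary.PropositionalEquality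
  using (_≡_; _≢_; refl; sym; trans; cong; subst)
open import Relation.Nullary using (¬_; does; yes; no; contradiction)
open import Relation.Nullary.Decidable using (dec-true; toSum; _×-dec_)
open import Relation.Unary using (Pred) renaming (Decidable to Decidable₁)

open Graph

private
  variable
    n   : ℕ
    x y : Fin n
    p q : List (Fin n)
    P   : Pred (Fin n) 0ℓ
    R S : Rel (Fin n) 0ℓ

-- Walks and paths

infixr 5 _∷_

-- The vertex list is an index, so that the list of an `IsPath` can be analysed by induction on
-- steps; distinctness is carried separately as `Unique p`.
data Walk (R : Rel (Fin n) 0ℓ) : Fin n → Fin n → List (Fin n) → Set where
  stop : ∀ x → Walk R x x (x ∷ [])
  _∷_  : ∀ {x y z p} → R x y → Walk R y z p → Walk R x z (x ∷ p)

Induced : Rel (Fin n) 0ℓ → Pred (Fin n) 0ℓ → Rel (Fin n) 0ℓ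
Induced R P u v = R u v × P u × P v

walk-map : (∀ {u v} → R u v → S u v) → Walk R x y p → Walk S x y p
walk-map f (stop x) = stop x
walk-map f (r ∷ w)  = f r ∷ walk-map f w

walk-start : Walk R x y p → Prefix _≡_ (x ∷ []) p
walk-start (stop x) = refl ∷ []
walk-start (r ∷ w)  = refl ∷ []

walk-start-unique : ∀ {v} → Walk R x y p → Prefix _≡_ (v ∷ []) p → v ≡ x
walk-start-unique (stop x) (v≡x ∷ _) = v≡x
walk-start-unique (r ∷ w)  (v≡x ∷ _) = v≡x

start∈walk : Walk R x y p → x List.∈ p
start∈walk (stop x) = here refl
start∈walk (r ∷ w)  = here refl

end∈walk : Walk R x y p → y List.∈ p
end∈walk (stop x) = here refl
end∈walk (r ∷ w)  = there (end∈walk w)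

walk-head : Walk R x y p → head p ≡ just x
walk-head (stop x) = refl
walk-head (r ∷ w)  = refl

walk-last : Walk R x y p → last p ≡ just y
walk-last (stop x)        = refl
walk-last (r ∷ stop x)    = refl
walk-last (r ∷ w@(_ ∷ _)) = walk-last w

walk-linked : Walk R x y p → Linked R p
walk-linked (stop x)        = [-]
walk-linked (r ∷ stop x)    = r ∷ [-]
walk-linked (r ∷ w@(_ ∷ _)) = r ∷ walk-linked w

linked⇒walk : head p ≡ just x → last p ≡ just y → Linked R p → Walk R x y p
linked⇒walk refl refl [-]      = stop _
linked⇒walk refl l    (r ∷ rs) = r ∷ linked⇒walk refl l rs

walk-all : (∀ {u v} → R u v → P v) → P x → Walk R x y p → All P p
walk-all f Px (stop x) = Px ∷ []
walk-all f Px (r ∷ w)  = Px ∷ walk-all f (f r) w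

restrict : Walk R x y p → All P p → Walk (Induced R P) x y p
restrict (stop x) _         = stop x
restrict (r ∷ w)  (Px ∷ Pp) = (r , Px , All.lookup Pp (start∈walk w)) ∷ restrict w Pp

walk⇒star : Walk R x y p → Star R x y
walk⇒star (stop x) = ε
walk⇒star (r ∷ w)  = r ◅ walk⇒star w

walk-from : ∀ {u} → Walk R x y p → Unique p → u List.∈ p →
            ∃[ q ] Walk R u y q × Unique q
walk-from w@(stop _) U       (here refl) = _ , w , U
walk-from w@(_ ∷ _)  U       (here refl) = _ , w , U
walk-from (_ ∷ w)    (_ ∷ U) (there u∈p) = walk-from w U u∈p

-- Loop erasure: if `x` recurs on the path built from its successor, the part of that path starting
-- at `x` replaces it.
star⇒path : Star R x y → ∃[ p ] Walk R x y p × Unique p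
star⇒path {x = x} ε = x ∷ [] , stop x , [] ∷ []
star⇒path {x = x} (r ◅ rs) with star⇒path rs
... | p , w , U with DecMembership._∈?_ _≟_ x p
...   | yes x∈p = walk-from w U x∈p
...   | no  x∉p = x ∷ p , r ∷ w , ¬Any⇒All¬ p x∉p ∷ U

path⇒walk : (H : Graph n) → IsPath H x y p → Walk (_~_ H) x y p
path⇒walk H (mkPath s e _ l _) = linked⇒walk s e l

walk⇒path : (H : Graph n) → x ∈ V H → Walk (_~_ H) x y p → Unique p → IsPath H x y p
walk⇒path H x∈V w U = mkPath (walk-head w) (walk-last w)
  (walk-all (~⇒∈V H ∘ ~-sym H) x∈V w) (walk-linked w) U

-- Uniqueness of paths in acyclic graphs

module _ (G : Graph n) (acyclic : ∀ c → ¬ IsCycle G c) where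

  private _~G_ = _~_ G

  -- A path from `a` to `b` avoiding `x` closes up through `x` to a cycle, which has at least three
  -- vertices because `a ≢ b`.
  no-detour : ∀ {x a b} → x ~G a → x ~G b → a ≢ b →
              ¬ Star (Induced _~G_ (x ≢_)) a b
  no-detour {x} {a} {b} x~a x~b a≢b s with star⇒path s
  ... | p , w , U = acyclic (x ∷ p)
    ( long w , x≢p ∷ U , walk-linked cycle , x , b , refl , walk-last cycle , ~-sym G x~b)
    where
    cycle = x~a ∷ walk-map proj₁ w
    x≢p   = walk-all (proj₂ ∘ proj₂) (λ x≡a → ~-irr G x≡a x~a) w
    long : ∀ {R : Rel (Fin n) 0ℓ} {p} → Walk R a b p → 3 ≤ length (x ∷ p)
    long (stop _)      = contradiction refl a≢b
    long (_ ∷ stop _)  = s≤s (s≤s (s≤s z≤n))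
    long (_ ∷ (_ ∷ _)) = s≤s (s≤s (s≤s z≤n))

  -- Where two paths first diverge, their remainders avoid the vertex just left and meet at `y`,
  -- joining two distinct neighbours of that vertex: a detour.
  path-unique : Walk _~G_ x y p → Unique p → Walk _~G_ x y q → Unique q → p ≡ q
  path-unique (stop _) _        (stop _) _        = refl
  path-unique (stop _) _        (_ ∷ w)  (x∉ ∷ _) =
    contradiction refl (All.lookup x∉ (end∈walk w))
  path-unique (_ ∷ w)  (x∉ ∷ _) (stop _) _        =
    contradiction refl (All.lookup x∉ (end∈walk w))
  path-unique (_∷_ {y = a} r w) (x∉p ∷ U) (_∷_ {y = b} r′ w′) (x∉q ∷ U′) with a ≟ b
  ... | yes refl = cong (_ ∷_) (path-unique w U w′ U′)
  ... | no  a≢b  = contradiction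
    (walk⇒star (restrict w x∉p) ◅◅ Star.reverse rev (walk⇒star (restrict w′ x∉q)))
    (no-detour r r′ a≢b)
    where
    rev : ∀ {x} → Symmetric (Induced _~G_ (x ≢_))
    rev (e , x≢u , x≢v) = ~-sym G e , x≢v , x≢u

  -- Every path of `K` is a path of `G`, so `p` is the only candidate for a shortest path. `K` will
  -- be `G ∖ F` or one of its components.
  path-monitors : (K : Graph n) → (∀ {u v} → _~_ K u v → u ~G v) →
                  ∀ {u v} → Walk (_~_ K) x y p → Unique p → EdgeOn u v p →
                  Monitors K x y u v
  path-monitors K K⊆G w U e q (π , _) = subst (EdgeOn _ _)
    (path-unique (walk-map K⊆G w) U (walk-map K⊆G (path⇒walk K π)) (IsPath.distinct π)) e

  -- Being the only path between its ends, `p` is a shortest one.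
  monitored-on-path : ∀ {u v} → Monitors G x y u v → IsPath G x y p → EdgeOn u v p
  monitored-on-path mon π = mon _ (π , λ q ρ → ℕ.≤-reflexive (cong length
    (path-unique (path⇒walk G π) (IsPath.distinct π) (path⇒walk G ρ) (IsPath.distinct ρ))))

-- Truncating paths at removed edges

NonIsolated : Rel (Fin n) 0ℓ → Pred (Fin n) 0ℓ
NonIsolated S x = ∃[ y ] S x y

-- To be used with `R` the adjacency of `G`, `S` that of `G ∖ F`, and `T` the vertices of `M` and
-- the endpoints of `F`; then `cut` holds since a removed edge belongs to `F`.
module _ {R S : Rel (Fin n) 0ℓ} (S? : Decidable S) (S-sym : Symmetric S)
         {T : Pred (Fin n) 0ℓ} (cut : ∀ {u v} → R u v → ¬ S u v → T u × T v) where

  -- The path is followed up to `y` or to the first step outside `S`; the stopping vertex lies in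
  -- `T` either way. It is non-isolated by assumption if it is `x`, and otherwise by the edge just
  -- traversed. The sublist keeps vertices distinct when the path is prolonged.
  truncate-end : Walk R x y p → Unique p → T y → NonIsolated S x →
    ∃[ y′ ] ∃[ q ] T y′ × NonIsolated S y′ × Walk S x y′ q × Unique q × Sublist q p
  truncate-end (stop x) _ Ty nx =
    x , x ∷ [] , Ty , nx , stop x , [] ∷ [] , refl ∷ []
  truncate-end (_∷_ {x} {v} r w) (x∉ ∷ U) Ty nx with S? x v
  ... | no ¬s = x , x ∷ [] , proj₁ (cut r ¬s) , nx , stop x , [] ∷ [] , refl ∷ minimum _
  ... | yes s with truncate-end w U Ty (x , S-sym s)
  ...   | y′ , q , Ty′ , ny′ , w′ , U′ , q⊆p =
    y′ , x ∷ q , Ty′ , ny′ , s ∷ w′ , All-resp-⊆ q⊆p x∉ ∷ U′ , refl ∷ q⊆p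

  -- The start x need not satisfy T: during the recursion of truncate it is an
  -- inner vertex of the path, from which the truncated path may still be prolonged.
  record Truncation (u v x : Fin n) (p : List (Fin n)) : Set where
    constructor mkTruncation
    field
      {x′ y′}  : Fin n
      {path}   : List (Fin n)
      start    : T x′ ⊎ x′ ≡ x
      start-ni : NonIsolated S x′
      end      : T y′
      end-ni   : NonIsolated S y′
      walk     : Walk S x′ y′ path
      unique   : Unique path
      edge     : Infix _≡_ (u ∷ v ∷ []) path
      sublist  : Sublist path p

  -- The recursion descends to the edge `uv`, cuts the part behind it with `truncate-end`, and on
  -- the way back prolongs the path towards `x` until a step outside `S`.
  truncate : ∀ {u v} → Walk R x y p → Unique p → T y → S u v →
             Infix _≡_ (u ∷ v ∷ []) p → Truncation u v x p
  truncate (stop _) _ _ _ (here (_ ∷ ()))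
  truncate (stop _) _ _ _ (there (here ()))
  truncate (_ ∷ w) (x∉ ∷ U) Ty s (here (refl ∷ v≡)) with walk-start-unique w v≡
  ... | refl with truncate-end w U Ty (_ , S-sym s)
  ...   | y′ , q , Ty′ , ny′ , w′ , U′ , q⊆p = mkTruncation
    (inj₂ refl) (_ , s) Ty′ ny′ (s ∷ w′) (All-resp-⊆ q⊆p x∉ ∷ U′)
    (here (refl ∷ walk-start w′)) (refl ∷ q⊆p)
  truncate (_∷_ {x} {z} r w) (x∉ ∷ U) Ty s (there i) with truncate w U Ty s i
  ... | mkTruncation (inj₁ Tx′) nx′ Ty′ ny′ w′ U′ i′ q⊆p =
    mkTruncation (inj₁ Tx′) nx′ Ty′ ny′ w′ U′ i′ (x ∷ʳ q⊆p)
  ... | mkTruncation (inj₂ refl) nz Ty′ ny′ w′ U′ i′ q⊆p with S? x z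
  -- The step from `x` to `z` is removed, so `z` lies in `T` and becomes the final start.
  ...   | no ¬s = mkTruncation
    (inj₁ (proj₂ (cut r ¬s))) nz Ty′ ny′ w′ U′ i′ (x ∷ʳ q⊆p)
  ...   | yes s′ = mkTruncation
    (inj₂ refl) (z , s′) Ty′ ny′ (s′ ∷ w′) (All-resp-⊆ q⊆p x∉ ∷ U′) (there i′) (refl ∷ q⊆p)

  truncate-path : ∀ {u v} → Walk R x y p → Unique p → T x → T y → S u v →
    EdgeOn u v p →
    ∃[ x′ ] ∃[ y′ ] ∃[ q ] (T x′ × NonIsolated S x′) × (T y′ × NonIsolated S y′) ×
      Walk S x′ y′ q × Unique q × EdgeOn u v q
  truncate-path w U Tx Ty s (inj₁ i) with truncate w U Ty s i
  ... | mkTruncation tx′ nx′ Ty′ ny′ w′ U′ i′ _ =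
    _ , _ , _ , ([ id , (λ { refl → Tx }) ]′ tx′ , nx′) , (Ty′ , ny′) , w′ , U′ , inj₁ i′
  truncate-path w U Tx Ty s (inj₂ i)
    with truncate-path w U Tx Ty (S-sym s) (inj₁ i)
  ... | _ , _ , _ , tx , ty , w′ , U′ , on = _ , _ , _ , tx , ty , w′ , U′ , swap on

-- Components

module _ (H : Graph n) {C : Subset n} (comp : IsComponent H C) where

  -- Adding the neighbour `b` to `C` leaves it connected, every vertex still reaching `a`;
  -- maximality of `C` then gives the claim.
  component-closed : ∀ {a b} → a ∈ C → _~_ H a b → b ∈ C
  component-closed {a} {b} a∈C a~b =
    maximal D D⊆V (p⊆p∪q ⁅ b ⁆) ((a , a∈D′) , connect) b∈D
    where
    C⊆V     = proj₁ comp
    C-conn  = proj₂ (proj₁ (proj₂ comp))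
    maximal = proj₂ (proj₂ comp)
    D    = C ∪ ⁅ b ⁆
    H[D] = H [ D ]
    a∈D  = p⊆p∪q ⁅ b ⁆ a∈C
    b∈D  = q⊆p∪q C ⁅ b ⁆ (x∈⁅x⁆ b)
    D⊆V : D ⊆ V H
    D⊆V d∈D with x∈p∪q⁻ C ⁅ b ⁆ d∈D
    ... | inj₁ d∈C = C⊆V d∈C
    ... | inj₂ d∈b with refl ← x∈⁅y⁆⇒x≡y b d∈b = ~⇒∈V H (~-sym H a~b)
    a∈D′ = x∈p∩q⁺ (C⊆V a∈C , a∈D)
    reach : ∀ {d} → d ∈ D → Star (_~_ H[D]) d a
    reach {d} d∈D with x∈p∪q⁻ C ⁅ b ⁆ d∈D
    ... | inj₁ d∈C = walk⇒star (walk-map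
      (λ (e , u∈C , v∈C) → e , p⊆p∪q ⁅ b ⁆ u∈C , p⊆p∪q ⁅ b ⁆ v∈C)
      (path⇒walk (H [ C ]) (proj₂
        (C-conn d a (x∈p∩q⁺ (C⊆V d∈C , d∈C)) (x∈p∩q⁺ (C⊆V a∈C , a∈C))))))
    ... | inj₂ d∈b with refl ← x∈⁅y⁆⇒x≡y b d∈b = (~-sym H a~b , b∈D , a∈D) ◅ ε
    connect : ∀ x y → x ∈ V H[D] → y ∈ V H[D] → ∃[ p ] IsPath H[D] x y p
    connect x y x∈ y∈ with star⇒path
      (reach (p∩q⊆q (V H) D x∈) ◅◅
       Star.reverse (λ {u} {v} → ~-sym H[D] {u} {v}) (reach (p∩q⊆q (V H) D y∈)))
    ... | p , w , U = p , walk⇒path H[D] x∈ w U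

  walk-in-component : Walk (_~_ H) x y p → Any (_∈ C) p → All (_∈ C) p
  walk-in-component (stop _) (here x∈C)  = x∈C ∷ []
  walk-in-component (r ∷ w)  (here x∈C)  =
    x∈C ∷ walk-in-component w (List.lose (start∈walk w) (component-closed x∈C r))
  walk-in-component (r ∷ w)  (there any) =
    let all = walk-in-component w any
    in  component-closed (All.lookup all (start∈walk w)) (~-sym H r) ∷ all

  -- The neighbour of `x` also lies in `C`, so `⁅ x ⁆` is a proper subset of `C`.
  nonIsolated⇒∣C∣≢1 : x ∈ C → NonIsolated (_~_ H) x → ∣ C ∣ ≢ 1
  nonIsolated⇒∣C∣≢1 {x = x} x∈C (y , x~y) ∣C∣≡1 =
    ℕ.<-irrefl (trans (∣⁅x⁆∣≡1 x) (sym ∣C∣≡1)) (p⊂q⇒∣p∣<∣q∣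
      ( (λ z∈ → subst (_∈ C) (sym (x∈⁅y⁆⇒x≡y x z∈)) x∈C)
      , y , component-closed x∈C x~y , λ y∈ → ~-irr H (sym (x∈⁅y⁆⇒x≡y x y∈)) x~y))

infix-head : ∀ {u v : Fin n} {p} → P u → Infix _≡_ (u ∷ v ∷ []) p → Any P p
infix-head Pu (here (refl ∷ _)) = here Pu
infix-head Pu (there i)         = there (infix-head Pu i)

edgeOn⇒Any : ∀ {u v : Fin n} {p} → P u → P v → EdgeOn u v p → Any P p
edgeOn⇒Any Pu Pv (inj₁ i) = infix-head Pu i
edgeOn⇒Any Pu Pv (inj₂ i) = infix-head Pv i

-- Cardinalities of subsets and the value of meg

select : {P : Pred (Fin n) 0ℓ} → Decidable₁ P → Subset n
select P? = tabulate (does ∘ P?)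

module _ {P : Pred (Fin n) 0ℓ} (P? : Decidable₁ P) where

  ∈-select⁺ : P x → x ∈ select P?
  ∈-select⁺ {x = x} Px = lookup⇒[]= x _
    (trans (lookup∘tabulate (does ∘ P?) x) (dec-true (P? x) Px))

  ∈-select⁻ : x ∈ select P? → P x
  ∈-select⁻ {x = x} x∈ with P? x | trans (sym (lookup∘tabulate (does ∘ P?) x)) ([]=⇒lookup x∈)
  ... | yes Px | _ = Px

∣p∪q∣≤∣p∣+∣q∣ : (p q : Subset n) → ∣ p ∪ q ∣ ≤ ∣ p ∣ + ∣ q ∣
∣p∪q∣≤∣p∣+∣q∣ []            []            = z≤n
∣p∪q∣≤∣p∣+∣q∣ (outside ∷ p) (outside ∷ q) = ∣p∪q∣≤∣p∣+∣q∣ p q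
∣p∪q∣≤∣p∣+∣q∣ (inside ∷ p)  (outside ∷ q) = s≤s (∣p∪q∣≤∣p∣+∣q∣ p q)
∣p∪q∣≤∣p∣+∣q∣ (outside ∷ p) (inside ∷ q)  =
  subst (suc ∣ p ∪ q ∣ ≤_) (sym (ℕ.+-suc ∣ p ∣ ∣ q ∣)) (s≤s (∣p∪q∣≤∣p∣+∣q∣ p q))
∣p∪q∣≤∣p∣+∣q∣ (inside ∷ p)  (inside ∷ q)  =
  s≤s (ℕ.≤-trans (∣p∪q∣≤∣p∣+∣q∣ p q) (ℕ.+-monoʳ-≤ ∣ p ∣ (ℕ.n≤1+n ∣ q ∣)))

endpoints : List (Fin n × Fin n) → Subset n
endpoints []            = ⊥
endpoints ((a , b) ∷ F) = (⁅ a ⁆ ∪ ⁅ b ⁆) ∪ endpoints F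

∣endpoints∣≤ : (F : List (Fin n × Fin n)) → ∣ endpoints F ∣ ≤ length F * 2
∣endpoints∣≤ {n} []        = ℕ.≤-reflexive (∣⊥∣≡0 n)
∣endpoints∣≤ ((a , b) ∷ F) = begin
  ∣ (⁅ a ⁆ ∪ ⁅ b ⁆) ∪ endpoints F ∣      ≤⟨ ∣p∪q∣≤∣p∣+∣q∣ (⁅ a ⁆ ∪ ⁅ b ⁆) (endpoints F) ⟩
  ∣ ⁅ a ⁆ ∪ ⁅ b ⁆ ∣ + ∣ endpoints F ∣    ≤⟨ ℕ.+-mono-≤ (∣p∪q∣≤∣p∣+∣q∣ ⁅ a ⁆ ⁅ b ⁆) (∣endpoints∣≤ F) ⟩
  ∣ ⁅ a ⁆ ∣ + ∣ ⁅ b ⁆ ∣ + length F * 2   ≡⟨ cong (λ m → m + ∣ ⁅ b ⁆ ∣ + length F * 2) (∣⁅x⁆∣≡1 a) ⟩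
  1 + ∣ ⁅ b ⁆ ∣ + length F * 2           ≡⟨ cong (λ m → 1 + m + length F * 2) (∣⁅x⁆∣≡1 b) ⟩
  2 + length F * 2                       ∎
  where open ℕ.≤-Reasoning

∈-endpoints : ∀ {a b} (F : List (Fin n × Fin n)) → (a , b) List.∈ F →
              a ∈ endpoints F × b ∈ endpoints F
∈-endpoints ((a , b) ∷ F) (here refl) =
  p⊆p∪q _ (p⊆p∪q _ (x∈⁅x⁆ a)) , p⊆p∪q _ (q⊆p∪q ⁅ a ⁆ _ (x∈⁅x⁆ b))
∈-endpoints ((a , b) ∷ F) (there ab∈F) =
  let a∈ , b∈ = ∈-endpoints F ab∈F
  in  q⊆p∪q (⁅ a ⁆ ∪ ⁅ b ⁆) _ a∈ , q⊆p∪q (⁅ a ⁆ ∪ ⁅ b ⁆) _ b∈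

∈-subsets : (C : Subset n) → C List.∈ subsets n
∈-subsets []            = here refl
∈-subsets (inside ∷ C)  = ∈-++⁺ˡ (∈-map⁺ (inside ∷_) (∈-subsets C))
∈-subsets (outside ∷ C) = ∈-++⁺ʳ (map (inside ∷_) (subsets _)) (∈-map⁺ (outside ∷_) (∈-subsets C))

min-map-filter-sel : {A : Set} {P : Pred A 0ℓ} (P? : Decidable₁ P) (f : A → ℕ)
  (m : ℕ) (xs : List A) →
  let μ = min m (map f (filter P? xs)) in μ ≡ m ⊎ ∃[ x ] P x × μ ≡ f x
min-map-filter-sel P? f m xs with argmin-sel id m (map f (filter P? xs))
... | inj₁ μ≡m = inj₁ μ≡m
... | inj₂ μ∈ with ∈-map⁻ f μ∈
...   | x , x∈ , μ≡fx = inj₂ (x , proj₂ (∈-filter⁻ P? {xs = xs} x∈) , μ≡fx)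

meg≤n : (H : Graph n) → meg H ≤ n
meg≤n {n} H = min≤⊤ n (map ∣_∣ (filter (isMEGSet? H) (subsets n)))

meg≤ : (H : Graph n) {M : Subset n} → IsMEGSet H M → meg H ≤ ∣ M ∣
meg≤ {n} H {M} meg-M = All.lookup (min≤xs n _)
  (∈-map⁺ ∣_∣ (∈-filter⁺ (isMEGSet? H) (∈-subsets M) meg-M))

-- The first alternative is the default value of the minimum.
meg-attained : (H : Graph n) → meg H ≡ n ⊎ ∃[ M ] IsMEGSet H M × meg H ≡ ∣ M ∣
meg-attained {n} H = min-map-filter-sel (isMEGSet? H) ∣_∣ n (subsets n)

-- A MEG-set after removing the edges

module _ (G : Graph n) (tree : IsTree G) (F : List (Fin n × Fin n)) {M : Subset n}
         (M⊆V : M ⊆ V G) (mon : MonitorsAllEdges G M) where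

  private
    H       = G ∖ F
    T       = M ∪ endpoints F
    acyclic = proj₂ tree

    chosen? : Decidable₁ (λ x → x ∈ T × NonIsolated (_~_ H) x)
    chosen? x = (x ∈? T) ×-dec any? (_~?_ H x)

  -- Isolated vertices are dropped because a MEG-set of a disconnected graph must not meet a
  -- component of size one.
  chosen : Subset n
  chosen = select chosen?

  removed⇒endpoints : ∀ {u v} → _~_ G u v → ¬ _~_ H u v → u ∈ T × v ∈ T
  removed⇒endpoints {u} {v} u~v ¬u~v
    with DecMembership._∈?_ pair≟ (u , v) F | DecMembership._∈?_ pair≟ (v , u) F
  ... | yes uv∈F | _ =
    let u∈ , v∈ = ∈-endpoints F uv∈F in q⊆p∪q M _ u∈ , q⊆p∪q M _ v∈
  ... | no _ | yes vu∈F =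
    let v∈ , u∈ = ∈-endpoints F vu∈F in q⊆p∪q M _ u∈ , q⊆p∪q M _ v∈
  ... | no uv∉F | no vu∉F = contradiction (u~v , uv∉F , vu∉F) ¬u~v

  edge-on-chosen-path : ∀ {u v} → _~_ H u v →
    ∃[ x ] ∃[ y ] ∃[ p ] x ∈ chosen × y ∈ chosen ×
      Walk (_~_ H) x y p × Unique p × EdgeOn u v p
  edge-on-chosen-path {u} {v} e
    with mon u v (proj₁ e)
  ... | x , y , x∈M , y∈M , m
    with proj₂ (proj₁ tree) x y (M⊆V x∈M) (M⊆V y∈M)
  ... | p , π
    with truncate-path (_~?_ H) (λ {u} {v} → ~-sym H {u} {v}) removed⇒endpoints
           (path⇒walk G π) (IsPath.distinct π)
           (p⊆p∪q _ x∈M) (p⊆p∪q _ y∈M) e (monitored-on-path G acyclic m π)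
  ... | x′ , y′ , q , cx , cy , w , U , on =
    x′ , y′ , q , ∈-select⁺ chosen? cx , ∈-select⁺ chosen? cy , w , U , on

  isMEGSet-∖ : IsMEGSet (G ∖ F) chosen
  isMEGSet-∖ = (λ x∈ → let _ , _ , x~y = ∈-select⁻ chosen? x∈ in ~⇒∈V H x~y) ,
    [ (λ conn → inj₁ (conn , monitored-edges))
    , (λ ¬conn → inj₂ (¬conn , monitored-component)) ]′ (toSum (connected? H))
    where
    monitored-component : ∀ C → IsComponent H C →
      MonitorsAllEdges (H [ C ]) (chosen ∩ C) ×
      (∣ C ∣ ≡ 1 → Empty (chosen ∩ C))
    monitored-component C comp = edges , λ ∣C∣≡1 (x , x∈) →
      let x∈M′ , x∈C = x∈p∩q⁻ chosen C x∈
      in  nonIsolated⇒∣C∣≢1 H comp x∈C (proj₂ (∈-select⁻ chosen? x∈M′)) ∣C∣≡1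
      where
      edges : MonitorsAllEdges (H [ C ]) (chosen ∩ C)
      edges u v (e , u∈C , v∈C) with edge-on-chosen-path e
      ... | x , y , p , x∈ , y∈ , w , U , on =
        -- The path passes through `uv`, which lies in `C`, so all of it, ends included, stays in
        -- `C`.
        let p⊆C = walk-in-component H comp w (edgeOn⇒Any u∈C v∈C on)
        in  x , y , x∈p∩q⁺ (x∈ , All.lookup p⊆C (start∈walk w))
                  , x∈p∩q⁺ (y∈ , All.lookup p⊆C (end∈walk w))
                  , path-monitors G acyclic (H [ C ]) (proj₁ ∘ proj₁) (restrict w p⊆C) U on

    monitored-edges : MonitorsAllEdges H chosen
    monitored-edges u v e with edge-on-chosen-path e
    ... | x , y , p , x∈ , y∈ , w , U , on =
      x , y , x∈ , y∈ , path-monitors G acyclic H proj₁ w U on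

  meg-∖≤ : meg (G ∖ F) ≤ ∣ M ∣ + length F * 2
  meg-∖≤ = begin
    meg (G ∖ F)                ≤⟨ meg≤ (G ∖ F) isMEGSet-∖ ⟩
    ∣ chosen ∣                 ≤⟨ p⊆q⇒∣p∣≤∣q∣ (proj₁ ∘ ∈-select⁻ chosen?) ⟩
    ∣ M ∪ endpoints F ∣        ≤⟨ ∣p∪q∣≤∣p∣+∣q∣ M (endpoints F) ⟩
    ∣ M ∣ + ∣ endpoints F ∣    ≤⟨ ℕ.+-monoʳ-≤ ∣ M ∣ (∣endpoints∣≤ F) ⟩
    ∣ M ∣ + length F * 2       ∎
    where open ℕ.≤-Reasoning

-- m stands for meg G, which is kept opaque because Agda is very slow to compare
-- two unfolded occurrences of meg.  When meg G ≡ n, no MEG-set of G is needed.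
meg-∖≤meg : (G : Graph n) → IsTree G → ∀ {k} (F : List (Fin n × Fin n)) → length F ≤ k →
            ∀ {m} → m ≡ n ⊎ (∃[ M ] IsMEGSet G M × m ≡ ∣ M ∣) → meg (G ∖ F) ≤ m + 2 * k
meg-∖≤meg G tree F _ (inj₁ refl) = ℕ.≤-trans (meg≤n (G ∖ F)) (ℕ.m≤m+n _ _)
-- A tree is connected, so `M` monitors the edges of `G` as a whole.
meg-∖≤meg G tree F _ (inj₂ (M , (_ , inj₂ (¬conn , _)) , _)) =
  contradiction (proj₁ tree) ¬conn
meg-∖≤meg G tree {k} F ∣F∣≤k (inj₂ (M , (M⊆V , inj₁ (_ , mon)) , refl)) = begin
  meg (G ∖ F)             ≤⟨ meg-∖≤ G tree F M⊆V mon ⟩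
  ∣ M ∣ + length F * 2    ≤⟨ ℕ.+-monoʳ-≤ ∣ M ∣ (ℕ.*-monoˡ-≤ 2 ∣F∣≤k) ⟩
  ∣ M ∣ + k * 2           ≡⟨ cong (∣ M ∣ +_) (ℕ.*-comm k 2) ⟩
  ∣ M ∣ + 2 * k           ∎
  where open ℕ.≤-Reasoning

theorem3p4 : ∀ {n : ℕ} (G : Graph n) → IsTree G →
    ∀ (k : ℕ) (F : List (Fin n × Fin n)) →
    All (λ e → Graph._~_ G (proj₁ e) (proj₂ e)) F → length F ≤ k →
    (0 ≤ meg (G ∖ F)) × (meg (G ∖ F) ≤ meg G + 2 * k)
theorem3p4 G tree k F _ ∣F∣≤k = z≤n , meg-∖≤meg G tree F ∣F∣≤k (meg-attained G)
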